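{- Let $k\in\mathbb{N}\setminus\{0\}$. Any lattice $\mathcal{L}$ of regular subsets of $\mathbb{N}$ which is closed under decrement is also closed under $k$-root; that is, $L\in\mathcal{L}$ implies $\sqrt[k]{L}=\{x\in\mathbb{N}\mid x^k\in L\}\in\mathcal{L}$.
   Context: $\mathbb{N}=\{0,1,2,\ldots\}$. A lattice over a set $X$ is any non empty family of subsets of $X$ closed under (binary) union and intersection. For $L\subseteq\mathbb{N}$ and $i\in\mathbb{N}$, $L-i=\{x\in\mathbb{N}\mid x+i\in L\}$; a family $\mathcal{L}$ of subsets of $\mathbb{N}$ is closed under decrement if $L\in\mathcal{L}$ implies $L-1\in\mathcal{L}$. A subset of $\mathbb{N}$ is regular if it is recognized by a finite automaton in unary notation; equivalently, if it is the union of a finite set with finitely many arithmetic progressions $a+r\mathbb{N}$ ($a,r\in\mathbb{N}$, $r\geq1$). -}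

module Defs where

open import Level using (Level; _⊔_) renaming (suc to lsuc)
open import Data.Fin using (Fin)
open import Data.Fin.Subset as Subset using (Subset)
open import Data.List using (List; foldl; replicate)
open import Data.Nat using (ℕ; _+_; _^_)
open import Data.Product using (∃-syntax)
open import Data.Unit using (⊤; tt)
open import Function.Bundles using (_⇔_)
open import Relation.Binary.Definitions using (_Respects_)
open import Relation.Unary using (Pred; Satisfiable; _∈_; _∪_; _∩_; _≐_)

private
  variable
    a ℓ ℓ′ : Level

-- Subsets of X are predicates on X.  A family of subsets cannot distinguish
-- predicates with the same elements, which predicates do not give for free
-- without extensionality; this is the field `resp`.
record IsLattice {X : Set a} (𝓛 : Pred (Pred X ℓ) ℓ′) : Set (a ⊔ lsuc ℓ ⊔ ℓ′) where
  field
    resp     : 𝓛 Respects _≐_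
    nonempty : Satisfiable 𝓛
    ∪-closed : ∀ {L M} → L ∈ 𝓛 → M ∈ 𝓛 → (L ∪ M) ∈ 𝓛
    ∩-closed : ∀ {L M} → L ∈ 𝓛 → M ∈ 𝓛 → (L ∩ M) ∈ 𝓛

infixl 6 _-_

_-_ : Pred ℕ ℓ → ℕ → Pred ℕ ℓ
(L - i) x = (x + i) ∈ L

DecrementClosed : Pred (Pred ℕ ℓ) ℓ′ → Set (lsuc ℓ ⊔ ℓ′)
DecrementClosed 𝓛 = ∀ {L} → L ∈ 𝓛 → (L - 1) ∈ 𝓛

record FiniteAutomaton (Σ : Set a) : Set a where
  field
    states : ℕ
    start  : Fin states
    step   : Fin states → Σ → Fin states
    final  : Subset states

  Accepts : Pred (List Σ) _
  Accepts w = foldl step start w Subset.∈ final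

-- The unary notation of x is the word of length x over a one-letter alphabet.
unary : ℕ → List ⊤
unary x = replicate x tt

Regular : Pred (Pred ℕ ℓ) ℓ
Regular L = ∃[ A ] ∀ x → x ∈ L ⇔ FiniteAutomaton.Accepts A (unary x)

infix 9 √[_]_

√[_]_ : ℕ → Pred ℕ ℓ → Pred ℕ ℓ
(√[ k ] L) x = (x ^ k) ∈ L

{-# OPTIONS --safe #-}
-- Order ℕ by a ≼ b iff a + t ∈ L implies b + t ∈ L for every t.  If a ≼ b then,
-- with d the distance of a and b, the part of L above a is stable under y ↦ y + d
-- (if a ≤ b) or under y ↦ y − d (if b ≤ a).  For f x = x ^ k the distance of f a and
-- f b is a multiple of d, and f a ≥ a, f b ≥ b, so f a ∈ L implies f b ∈ L.  Hence
-- f⁻¹(L) is the union of the up-sets ⋂ { L − t ∣ a + t ∈ L } of its elements a.  The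
-- preimage also contains ⋂ₜ (L − t); adding this to the union is harmless and covers
-- an empty f⁻¹(L), which matters as ∅ need not lie in 𝓛 a priori.  As L is regular, finitely
-- many t and a suffice.
module Submission where

open import Level using (Level; 0ℓ)
open import Data.Nat using (ℕ; NonZero)
open import Relation.Unary using (Pred; _∈_)
open import Defs

open import Data.Fin using (Fin; toℕ)
open import Data.Fin.Properties using (pigeonhole; toℕ<n)
open import Data.Fin.Subset as Subset using ()
open import Data.Fin.Subset.Properties using (_∈?_)
open import Data.List using (List; foldl; filter; upTo)
open import Data.List.Membership.Propositional using (find; lose)
open import Data.List.Membership.Propositional.Properties
  using (∈-filter⁺; ∈-upTo⁺)
open import Data.List.Relation.Unary.All as All using (All; []; _∷_)
open import Data.List.Relation.Unary.All.Properties using (all-filter)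
open import Data.List.Relation.Unary.Any using (Any; here; there)
open import Data.Nat using (zero; suc; _+_; _*_; _∸_; _^_; _≤_; _<_; z≤n)
open import Data.Nat.Induction using (<-rec)
open import Data.Nat.Properties
open import Data.Nat.Solver using (module +-*-Solver)
open import Data.Product using (∃-syntax; _×_; _,_; proj₁; proj₂)
open import Data.Sum using (inj₁; inj₂)
open import Data.Unit using (⊤; tt)
open import Function.Base using (_∘_)
open import Function.Bundles using (mk⇔; module Equivalence)
open import Relation.Binary.PropositionalEquality
  using (_≡_; refl; sym; trans; cong; subst)
open import Relation.Nullary using (yes; no)
open import Relation.Nullary.Decidable using (map)
open import Relation.Unary using (Decidable; _∪_; _∩_)

private
  variable
    ℓ : Level
    I X : Set
    a b : ℕ
    L : Pred ℕ 0ℓ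

module _ {𝓛 : Pred (Pred X 0ℓ) ℓ} (isLattice : IsLattice 𝓛) where
  open IsLattice isLattice

  -- The seed `E` covers the empty list: a bare empty intersection would be all of `X`, which a
  -- lattice need not contain. The seed of `⋃-closed` likewise avoids ∅.
  ⋂-closed : ∀ {E} {F : I → Pred X 0ℓ} {ts} → E ∈ 𝓛 → All (λ t → F t ∈ 𝓛) ts →
             (E ∩ λ x → All (λ t → x ∈ F t) ts) ∈ 𝓛
  ⋂-closed E∈ []         = resp ((λ x∈E → x∈E , []) , proj₁) E∈
  ⋂-closed E∈ (F∈ ∷ Fs∈) = resp
    ( (λ (x∈F , x∈E , x∈Fs) → x∈E , x∈F ∷ x∈Fs)
    , (λ { (x∈E , x∈F ∷ x∈Fs) → x∈F , x∈E , x∈Fs }) )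
    (∩-closed F∈ (⋂-closed E∈ Fs∈))

  ⋃-closed : ∀ {E} {F : I → Pred X 0ℓ} {ts} → E ∈ 𝓛 → All (λ t → F t ∈ 𝓛) ts →
             (E ∪ λ x → Any (λ t → x ∈ F t) ts) ∈ 𝓛
  ⋃-closed E∈ []         = resp (inj₁ , λ { (inj₁ x∈E) → x∈E ; (inj₂ ()) }) E∈
  ⋃-closed E∈ (F∈ ∷ Fs∈) = resp
    ( (λ { (inj₁ x∈F)          → inj₂ (here x∈F)
         ; (inj₂ (inj₁ x∈E))   → inj₁ x∈E
         ; (inj₂ (inj₂ x∈Fs))  → inj₂ (there x∈Fs) })
    , (λ { (inj₁ x∈E)          → inj₂ (inj₁ x∈E)
         ; (inj₂ (here x∈F))   → inj₁ x∈F
         ; (inj₂ (there x∈Fs)) → inj₂ (inj₂ x∈Fs) }) )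
    (∪-closed F∈ (⋃-closed E∈ Fs∈))

module _ {𝓛 : Pred (Pred ℕ 0ℓ) ℓ} (isLattice : IsLattice 𝓛) where
  open IsLattice isLattice

  shift-closed : DecrementClosed 𝓛 → L ∈ 𝓛 → ∀ t → (L - t) ∈ 𝓛
  shift-closed {L} dec L∈ zero    =
    resp ((λ {x} → subst L (sym (+-identityʳ x))) , (λ {x} → subst L (+-identityʳ x))) L∈
  shift-closed {L} dec L∈ (suc t) =
    resp ((λ {x} → subst L (+-assoc x 1 t)) , (λ {x} → subst L (sym (+-assoc x 1 t))))
         (dec (shift-closed dec L∈ t))

module _ (A : FiniteAutomaton ⊤) where
  open FiniteAutomaton A

  state : ℕ → Fin states
  state x = foldl step start (unary x)

  foldl-unary-+ : ∀ s x t → foldl step s (unary (x + t)) ≡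
                  foldl step (foldl step s (unary x)) (unary t)
  foldl-unary-+ s zero    t = refl
  foldl-unary-+ s (suc x) t = foldl-unary-+ (step s tt) x t

  state-shift : ∀ a b → state a ≡ state b → ∀ t → state (a + t) ≡ state (b + t)
  state-shift a b eq t = trans (foldl-unary-+ start a t)
    (trans (cong (λ s → foldl step s (unary t)) eq) (sym (foldl-unary-+ start b t)))

  -- Two of the numbers up to `states` reach the same state, say i < j. Any x = j + r can then be
  -- lowered to i + r without changing its state, until it falls below the bound.
  state-early : ∀ x → ∃[ y ] y < suc states × state x ≡ state y
  state-early with pigeonhole (n<1+n states) (state ∘ toℕ)
  ... | i , j , i<j , eq = <-rec _ λ x rec → case x rec
    where
    case : ∀ x → (∀ {z} → z < x → ∃[ y ] y < suc states × state z ≡ state y) →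
           ∃[ y ] y < suc states × state x ≡ state y
    case x rec with x <? suc states
    ... | yes x< = x , x< , refl
    ... | no  x≮ =
      let j≤x = ≤-trans (<⇒≤ (toℕ<n j)) (≮⇒≥ x≮)
          r   = x ∸ toℕ j
          j+r≡x = m+[n∸m]≡n j≤x
          y , y< , eq′ = rec (subst (toℕ i + r <_) j+r≡x (+-monoˡ-< r i<j))
      in  y , y< , trans (cong state (sym j+r≡x)) (trans (sym (state-shift (toℕ i) (toℕ j) eq r)) eq′)

-- Needed so that `filter` can cut out the finite lists `times` and `reps`.
regular⇒decidable : Regular L → Decidable L
regular⇒decidable (A , L⇔A) x =
  map (mk⇔ (Equivalence.from (L⇔A x)) (Equivalence.to (L⇔A x))) (state A x ∈? FiniteAutomaton.final A)

infix 4 _⊢_≼_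

_⊢_≼_ : Pred ℕ 0ℓ → ℕ → ℕ → Set
L ⊢ a ≼ b = ∀ t → (a + t) ∈ L → (b + t) ∈ L

-- Mutual `≼` is the Nerode congruence of `L`; it is coarser than or equal to equality of reached
-- states, so its classes have representatives below `N`.
regular⇒finiteIndex : Regular L → ∃[ N ] ∀ x → ∃[ y ] y < N × L ⊢ x ≼ y × L ⊢ y ≼ x
regular⇒finiteIndex {L} (A , L⇔A) = suc (FiniteAutomaton.states A) , λ x →
  let y , y< , eq = state-early A x in y , y< , transport x y eq , transport y x (sym eq)
  where
  transport : ∀ a b → state A a ≡ state A b → L ⊢ a ≼ b
  transport a b eq t = Equivalence.from (L⇔A (b + t))
    ∘ subst (λ s → s Subset.∈ FiniteAutomaton.final A) (state-shift A a b eq t)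
    ∘ Equivalence.to (L⇔A (a + t))

module _ (L : Pred ℕ 0ℓ) {d : ℕ} where
  open +-*-Solver

  -- Any y at or above a is a + t with t = y ∸ a, so the hypothesis at t moves y to y + d, which is
  -- again above a.
  climb : L ⊢ a ≼ a + d → ∀ n {y} → a ≤ y → y ∈ L → (y + n * d) ∈ L
  climb a≼a+d zero    {y} a≤y y∈L = subst L (sym (+-identityʳ y)) y∈L
  climb {a} a≼a+d (suc n) {y} a≤y y∈L =
    subst L (+-assoc y d (n * d)) (climb a≼a+d n (m≤n⇒m≤n+o d a≤y) y+d∈L)
    where
    a+t≡y = m+[n∸m]≡n a≤y
    y+d∈L : (y + d) ∈ L
    y+d∈L = subst L
      (trans (solve 3 (λ a d t → a :+ d :+ t := a :+ t :+ d) refl a d (y ∸ a)) (cong (_+ d) a+t≡y))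
      (a≼a+d (y ∸ a) (subst L (sym a+t≡y) y∈L))

  -- The reverse of climbing: every landing point is still at or above a, so it has the form a + t
  -- and the hypothesis applies.
  descend : L ⊢ a + d ≼ a → ∀ n {y} → a ≤ y → (y + n * d) ∈ L → y ∈ L
  descend a+d≼a zero    {y} a≤y y∈L = subst L (+-identityʳ y) y∈L
  descend {a} a+d≼a (suc n) {y} a≤y y+nd∈L =
    subst L a+t≡y (a+d≼a (y ∸ a) (subst L
      (trans (cong (_+ d) (sym a+t≡y)) (solve 3 (λ a d t → a :+ t :+ d := a :+ d :+ t) refl a d (y ∸ a)))
      (descend a+d≼a n (m≤n⇒m≤n+o d a≤y) (subst L (sym (+-assoc y d (n * d))) y+nd∈L))))
    where
    a+t≡y = m+[n∸m]≡n a≤y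

Expansive : (ℕ → ℕ) → Set
Expansive f = ∀ x → x ≤ f x

-- Says both that f is monotone and that b − a divides f b − f a.
CongruencePreserving : (ℕ → ℕ) → Set
CongruencePreserving f = ∀ a d → ∃[ n ] f (a + d) ≡ f a + n * d

module _ {f : ℕ → ℕ} (x≤fx : Expansive f) (f-cong : CongruencePreserving f) where

  preimage-≼ : ∀ L → L ⊢ a ≼ b → f a ∈ L → f b ∈ L
  preimage-≼ {a} {b} L a≼b fa∈L with ≤-total a b
  ... | inj₁ a≤b with d , refl ← m≤n⇒∃[o]m+o≡n a≤b =
    let n , eq = f-cong a d
    in  subst L (sym eq) (climb L a≼b n (x≤fx a) fa∈L)
  ... | inj₂ b≤a with d , refl ← m≤n⇒∃[o]m+o≡n b≤a =
    let n , eq = f-cong b d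
    in  descend L a≼b n (x≤fx b) (subst L eq fa∈L)

  preimage-closed : {𝓛 : Pred (Pred ℕ 0ℓ) ℓ} → IsLattice 𝓛 → DecrementClosed 𝓛 →
                    Regular L → L ∈ 𝓛 → (L ∘ f) ∈ 𝓛
  preimage-closed {L = L} {𝓛} isLattice dec reg L∈
    with N , index ← regular⇒finiteIndex reg = resp (to , from) union∈
    where
    open IsLattice isLattice
    L? = regular⇒decidable reg

    shifts : ∀ ts → All (λ t → (L - t) ∈ 𝓛) ts
    shifts ts = All.universal (shift-closed isLattice dec L∈) ts

    times : ℕ → List ℕ
    times a = filter (λ t → L? (a + t)) (upTo N)

    -- The seed is harmless when `f a ∈ L`: as a + (f a ∸ a) = f a, it is itself one of the shifts L
    -- - t with a + t ∈ L.
    Up : ℕ → Pred ℕ 0ℓ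
    Up a = (L - (f a ∸ a)) ∩ λ x → All (λ t → x ∈ L - t) (times a)

    Tail : Pred ℕ 0ℓ
    Tail = L ∩ λ x → All (λ t → x ∈ L - t) (upTo N)

    reps : List ℕ
    reps = filter (L? ∘ f) (upTo N)

    union∈ : (Tail ∪ λ x → Any (λ a → x ∈ Up a) reps) ∈ 𝓛
    union∈ = ⋃-closed isLattice (⋂-closed isLattice L∈ (shifts _))
      (All.universal (λ a → ⋂-closed isLattice (shift-closed isLattice dec L∈ _) (shifts _)) reps)

    -- `≼` replaces the left summand; commuting allows the shift t to be replaced as well.
    swap : ∀ x {y} → (x + y) ∈ L → (y + x) ∈ L
    swap x {y} = subst L (+-comm x y)

    -- An arbitrary t is traded for its representative s < N: a + t ∈ L gives a + s ∈ L, so s is in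
    -- `times a`, hence b + s ∈ L, and s is traded back for t.
    Up⇒≼ : b ∈ Up a → L ⊢ a ≼ b
    Up⇒≼ {b} {a} (_ , b∈) t a+t∈L =
      let s , s<N , t≼s , s≼t = index t
      in  swap t (s≼t b (swap b (All.lookup b∈
            (∈-filter⁺ (λ t → L? (a + t)) (∈-upTo⁺ s<N) (swap s (t≼s a (swap a a+t∈L)))))))

    ≼⇒Up : f a ∈ L → L ⊢ a ≼ b → b ∈ Up a
    ≼⇒Up {a} fa∈L a≼b =
      a≼b _ (subst L (sym (m+[n∸m]≡n (x≤fx a))) fa∈L) ,
      All.map (a≼b _) (all-filter (λ t → L? (a + t)) (upTo N))

    Tail⇒ : b ∈ Tail → ∀ t → (b + t) ∈ L
    Tail⇒ {b} (_ , b∈) t =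
      let s , s<N , _ , s≼t = index t
      in  swap t (s≼t b (swap b (All.lookup b∈ (∈-upTo⁺ s<N))))

    to : ∀ {x} → x ∈ (Tail ∪ λ x → Any (λ a → x ∈ Up a) reps) → f x ∈ L
    -- Expansiveness makes f x one of the numbers x + t.
    to {x} (inj₁ x∈) = subst L (m+[n∸m]≡n (x≤fx x)) (Tail⇒ x∈ (f x ∸ x))
    to {x} (inj₂ x∈) =
      let a , a∈reps , x∈Up = find x∈
      in  preimage-≼ L (Up⇒≼ x∈Up) (All.lookup (all-filter (L? ∘ f) (upTo N)) a∈reps)

    from : ∀ {x} → f x ∈ L → x ∈ (Tail ∪ λ x → Any (λ a → x ∈ Up a) reps)
    from {x} fx∈L =
      -- Both directions matter: x ≼ a puts the representative a into `reps`, and a ≼ x puts x into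
      -- `Up a`.
      let a , a<N , x≼a , a≼x = index x
          fa∈L = preimage-≼ L x≼a fx∈L
      in  inj₂ (lose (∈-filter⁺ (L? ∘ f) (∈-upTo⁺ a<N) fa∈L) (≼⇒Up fa∈L a≼x))

^-expansive : ∀ k .{{_ : NonZero k}} → Expansive (_^ k)
^-expansive (suc k) zero      = z≤n
^-expansive (suc k) x@(suc _) = m≤m*n x (x ^ k) {{m^n≢0 x k}}

^-congruencePreserving : ∀ k → CongruencePreserving (_^ k)
^-congruencePreserving zero    a d = 0 , refl
^-congruencePreserving (suc k) a d =
  let n , eq = ^-congruencePreserving k a d
  -- The coefficient of d left after splitting a * a ^ k off the product (a + d) * (a ^ k + n * d).
  in  a * n + a ^ k + d * n ,
      trans (cong ((a + d) *_) eq)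
        (solve 4 (λ a d p n → (a :+ d) :* (p :+ n :* d) := a :* p :+ (a :* n :+ p :+ d :* n) :* d)
          refl a d (a ^ k) n)
  where open +-*-Solver

theorem2p2 : ∀ {ℓ : Level} (k : ℕ) .{{_ : NonZero k}}
    (𝓛 : Pred (Pred ℕ 0ℓ) ℓ) →
    IsLattice 𝓛 →
    (∀ {L} → L ∈ 𝓛 → Regular L) →
    DecrementClosed 𝓛 →
    ∀ {L} → L ∈ 𝓛 → (√[ k ] L) ∈ 𝓛
theorem2p2 k 𝓛 isLattice reg dec L∈ =
  preimage-closed (^-expansive k) (^-congruencePreserving k) isLattice dec (reg L∈) L∈
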